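{- $\frac{5}{9}\le c_1(C_5^{(3)})\le 2-\sqrt{2}$.
   Context: A $3$-graph is a $3$-uniform hypergraph. $C_5^{(3)}$ is the tight $5$-cycle: the $3$-graph on $5$ vertices with a cyclic ordering such that every $3$ cyclically consecutive vertices form an edge (5 edges in total). For a $3$-graph $G$, $\delta_1(G)$ is the minimum over vertices $v$ of the number of edges containing $v$; $G$ has an $F$-covering if every vertex of $G$ lies in a copy of $F$ in $G$. Set $c_1(n,F)=\max\{\delta_1(G): v(G)=n,\ G\text{ has no }F\text{ -covering}\}$ and $c_1(F)=\lim_{n\to\infty}c_1(n,F)/\binom{n-1}{2}$ (this limit exists). -}

module Defs where

open import Data.Nat using (ℕ; zero; suc; _+_; _*_; _∸_; _≤_; _<_; _<ᵇ_; _⊓_)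
open import Data.Nat.Combinatorics using (_C_)
open import Data.Bool using (Bool; true; false; _∧_; if_then_else_)
open import Data.Fin using (Fin; toℕ) renaming (zero to f0)
open import Data.List using (List; map; allFin; foldr)
open import Data.Nat.ListAction using (sum)
open import Data.Product using (Σ; _×_; ∃)
open import Function.Definitions using (Injective)
open import Relation.Binary.PropositionalEquality using (_≡_)

record ThreeGraph (n : ℕ) : Set where
  field
    edge   : Fin n → Fin n → Fin n → Bool
    sym₁₂  : ∀ a b c → edge a b c ≡ edge b a c
    sym₂₃  : ∀ a b c → edge a b c ≡ edge a c b
    irrefl : ∀ a c → edge a a c ≡ false
open ThreeGraph public

deg : ∀ {n} → ThreeGraph n → Fin n → ℕ
deg {n} G v =
  sum (map (λ a → sum (map (λ b →
        if (toℕ a <ᵇ toℕ b) ∧ edge G v a b then 1 else 0) (allFin n)))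
      (allFin n))

δ₁ : ∀ {m} → ThreeGraph (suc m) → ℕ
δ₁ {m} G = foldr _⊓_ (deg G f0) (map (deg G) (allFin (suc m)))

c0 c1 c2 c3 c4 : Fin 5
c0 = f0
c1 = Fin.suc f0
c2 = Fin.suc (Fin.suc f0)
c3 = Fin.suc (Fin.suc (Fin.suc f0))
c4 = Fin.suc (Fin.suc (Fin.suc (Fin.suc f0)))

IsC5Copy : ∀ {n} → ThreeGraph n → (Fin 5 → Fin n) → Set
IsC5Copy G f =
  Injective _≡_ _≡_ f ×
  edge G (f c0) (f c1) (f c2) ≡ true ×
  edge G (f c1) (f c2) (f c3) ≡ true ×
  edge G (f c2) (f c3) (f c4) ≡ true ×
  edge G (f c3) (f c4) (f c0) ≡ true ×
  edge G (f c4) (f c0) (f c1) ≡ true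

HasC5Covering : ∀ {n} → ThreeGraph n → Set
HasC5Covering {n} G =
  ∀ (v : Fin n) → Σ (Fin 5 → Fin n) λ f → IsC5Copy G f × ∃ λ i → f i ≡ v

{-# OPTIONS --safe #-}

-- Lower bound.  Colour one vertex hub, about two thirds of the others red and the rest blue.  The
-- link of the hub consists of the pairs of equal colour, and a hub-free triple is an edge when it is
-- not monochromatic.  A tight 5-cycle v a b c d through the hub v has the link path b-a-d-c, so
-- a, b, c, d have the same colour although abc is an edge.  Red has the smallest link away from the
-- hub, of density 1 − 4/9, and the link of the hub has density 4/9 + 1/9.
--
-- Upper bound.  Let L be the link of v, let b have at least average degree in L, put A = N_L(b),
-- B = V ∖ A, and let H be the link of b.  If v a b c d is never a tight 5-cycle then there are no
-- a ∈ A and c, d with cd ∈ L ∩ H, ad ∈ L and ac ∈ H.  So each a ∈ A sends at most 2 edges of the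
-- multigraph L + H to the ends of a double edge cd, and deleting double edges one at a time gives
-- 2 (e(L) + e(H)) ≤ n² + |B|².  With D = 2 δ₁(G) and |A| ≥ D / n this becomes
-- 2 n⁴ ≤ (2 n² − D)², that is D ≤ (2 − √2) n².

module Submission where

open import Defs
open import Data.Bool using (Bool; true; false; _∧_; not; if_then_else_)
import Data.Bool.Properties as Bool
open import Data.Empty using (⊥; ⊥-elim)
open import Data.Fin using (Fin; toℕ) renaming (zero to f0; suc to fsuc)
open import Data.Fin.Properties using (toℕ-injective; any?)
open import Data.List using (List; []; _∷_; map; length; filterᵇ; allFin; foldr; tabulate)
open import Data.List.Membership.Propositional using (_∈_; find)
open import Data.List.Membership.Propositional.Properties using (∈-∃++; ∈-map⁺; ∈-allFin)
open import Data.List.Properties using (length-tabulate; map-tabulate)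
open import Data.List.Relation.Binary.Permutation.Propositional using (_↭_; ↭-refl; ↭-trans; prep)
open import Data.List.Relation.Binary.Permutation.Propositional.Properties
  using (shift; map⁺; All-resp-↭; ∈-resp-↭; ↭-length)
open import Data.List.Relation.Unary.All as All using (All; []; _∷_)
open import Data.List.Relation.Unary.All.Properties using (¬All⇒Any¬)
open import Data.List.Relation.Unary.Any using (here; there)
open import Data.Nat
  using (ℕ; zero; suc; _+_; _*_; _∸_; _≤_; _<_; _≤?_; z≤n; s≤s; _<ᵇ_; _≡ᵇ_; _⊓_; _/_; _%_)
open import Data.Nat.Combinatorics using (_C_; nCk+nC[k+1]≡[n+1]C[k+1]; nC1≡n)
open import Data.Nat.DivMod using (m≡m%n+[m/n]*n; m%n<n)
open import Data.Nat.ListAction using (sum)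
open import Data.Nat.ListAction.Properties using (sum-↭)
open import Data.Nat.Properties
open import Data.Nat.Tactic.RingSolver using (solve-∀)
open import Data.Product using (Σ; ∃; _×_; _,_)
open import Data.Sum using (_⊎_; inj₁; inj₂)
open import Data.Vec using ([]; _∷_; lookup)
open import Data.Vec.Relation.Unary.All using ([]; _∷_)
open import Data.Vec.Relation.Unary.AllPairs using ([]; _∷_)
open import Data.Vec.Relation.Unary.Unique.Propositional.Properties using (lookup-injective)
open import Function using (_∘_)
open import Relation.Binary.PropositionalEquality
open import Relation.Nullary using (¬_; Dec; yes; no; contradiction)
open import Relation.Nullary.Decidable using (_×-dec_)

private
  variable
    X Y : Set
    n m : ℕ

-- Finite sums

⟦_⟧ : Bool → ℕ
⟦ t ⟧ = if t then 1 else 0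

∑ : List X → (X → ℕ) → ℕ
∑ xs f = sum (map f xs)

∑-cong : ∀ (xs : List X) {f g : X → ℕ} → (∀ x → f x ≡ g x) → ∑ xs f ≡ ∑ xs g
∑-cong []       _  = refl
∑-cong (x ∷ xs) eq = cong₂ _+_ (eq x) (∑-cong xs eq)

∑-mono-All : ∀ {xs : List X} {f g : X → ℕ} → All (λ x → f x ≤ g x) xs → ∑ xs f ≤ ∑ xs g
∑-mono-All []         = z≤n
∑-mono-All (le ∷ les) = +-mono-≤ le (∑-mono-All les)

∑-mono : ∀ (xs : List X) {f g : X → ℕ} → (∀ x → f x ≤ g x) → ∑ xs f ≤ ∑ xs g
∑-mono xs le = ∑-mono-All (All.universal le xs)

∑-const : ∀ (xs : List X) k → ∑ xs (λ _ → k) ≡ length xs * k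
∑-const []       k = refl
∑-const (x ∷ xs) k = cong (k +_) (∑-const xs k)

∑-≤-const : ∀ {xs : List X} {f : X → ℕ} {k} → All (λ x → f x ≤ k) xs → ∑ xs f ≤ length xs * k
∑-≤-const {xs = xs} {k = k} les = ≤-trans (∑-mono-All les) (≤-reflexive (∑-const xs k))

∑-+ : ∀ (xs : List X) (f g : X → ℕ) → ∑ xs (λ x → f x + g x) ≡ ∑ xs f + ∑ xs g
∑-+ []       f g = refl
∑-+ (x ∷ xs) f g = trans (cong (f x + g x +_) (∑-+ xs f g)) (interchange (f x) (g x) (∑ xs f) (∑ xs g))
  where
    interchange : ∀ a b c d → a + b + (c + d) ≡ a + c + (b + d)
    interchange = solve-∀

∑-*ˡ : ∀ (xs : List X) k (f : X → ℕ) → ∑ xs (λ x → k * f x) ≡ k * ∑ xs f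
∑-*ˡ []       k f = sym (*-zeroʳ k)
∑-*ˡ (x ∷ xs) k f = trans (cong (k * f x +_) (∑-*ˡ xs k f)) (sym (*-distribˡ-+ k (f x) (∑ xs f)))

∑∑-+ : ∀ (xs : List X) (ys : List Y) (f g : X → Y → ℕ) →
  ∑ xs (λ x → ∑ ys (λ y → f x y + g x y)) ≡ ∑ xs (λ x → ∑ ys (f x)) + ∑ xs (λ x → ∑ ys (g x))
∑∑-+ xs ys f g = trans (∑-cong xs (λ x → ∑-+ ys (f x) (g x))) (∑-+ xs _ _)

∑-product : ∀ (xs : List X) (ys : List Y) (f : X → ℕ) (g : Y → ℕ) →
            ∑ xs (λ x → ∑ ys (λ y → f x * g y)) ≡ ∑ xs f * ∑ ys g
∑-product xs ys f g = begin
  ∑ xs (λ x → ∑ ys (λ y → f x * g y)) ≡⟨ ∑-cong xs (λ x → trans (∑-*ˡ ys (f x) g) (*-comm (f x) _)) ⟩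
  ∑ xs (λ x → ∑ ys g * f x)           ≡⟨ ∑-*ˡ xs (∑ ys g) f ⟩
  ∑ ys g * ∑ xs f                     ≡⟨ *-comm (∑ ys g) _ ⟩
  ∑ xs f * ∑ ys g                     ∎
  where open ≡-Reasoning

∑-swap : ∀ (xs : List X) (ys : List Y) (f : X → Y → ℕ) →
         ∑ xs (λ x → ∑ ys (f x)) ≡ ∑ ys (λ y → ∑ xs (λ x → f x y))
∑-swap []       ys f = sym (trans (∑-const ys 0) (*-zeroʳ (length ys)))
∑-swap (x ∷ xs) ys f = trans (cong (∑ ys (f x) +_) (∑-swap xs ys f))
                             (sym (∑-+ ys (f x) (λ y → ∑ xs (λ x → f x y))))

∑-↭ : ∀ {xs ys : List X} (f : X → ℕ) → xs ↭ ys → ∑ xs f ≡ ∑ ys f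
∑-↭ f p = sum-↭ (map⁺ f p)

∑-filter : ∀ (t : X → Bool) (f : X → ℕ) xs →
           ∑ xs f ≡ ∑ (filterᵇ t xs) f + ∑ (filterᵇ (not ∘ t) xs) f
∑-filter t f []       = refl
∑-filter t f (x ∷ xs) with t x
... | true  = trans (cong (f x +_) (∑-filter t f xs)) (sym (+-assoc (f x) _ _))
... | false = trans (cong (f x +_) (∑-filter t f xs)) (exchange (f x) (∑ (filterᵇ t xs) f) _)
  where
    exchange : ∀ a b c → a + (b + c) ≡ b + (a + c)
    exchange = solve-∀

-- Symmetry of `w` makes the two mixed blocks equal, hence the factor 2. The right-hand side has the
-- shape of `total` below.
∑∑-filter : ∀ (w : X → X → ℕ) → (∀ x y → w x y ≡ w y x) → ∀ (t : X → Bool) xs →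
  let A = filterᵇ t xs; B = filterᵇ (not ∘ t) xs in
  ∑ xs (λ x → ∑ xs (w x)) ≡
  ∑ A (λ x → ∑ A (w x)) + 2 * ∑ A (λ x → ∑ B (w x)) + ∑ B (λ x → ∑ B (w x))
∑∑-filter w w-sym t xs = begin
  ∑ xs (λ x → ∑ xs (w x))
    ≡⟨ ∑-cong xs (λ x → ∑-filter t (w x) xs) ⟩
  ∑ xs (λ x → ∑ A (w x) + ∑ B (w x))
    ≡⟨ ∑-filter t _ xs ⟩
  ∑ A (λ x → ∑ A (w x) + ∑ B (w x)) + ∑ B (λ x → ∑ A (w x) + ∑ B (w x))
    ≡⟨ cong₂ _+_ (∑-+ A _ _) (∑-+ B _ _) ⟩
  AA + AB + (∑ B (λ x → ∑ A (w x)) + BB)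
    ≡⟨ cong (λ s → AA + AB + (s + BB)) (trans (∑-swap B A w) (∑-cong A (λ x → ∑-cong B (λ y → w-sym y x)))) ⟩
  AA + AB + (AB + BB)
    ≡⟨ double AA AB BB ⟩
  AA + 2 * AB + BB ∎
  where
    open ≡-Reasoning
    A = filterᵇ t xs
    B = filterᵇ (not ∘ t) xs
    AA = ∑ A (λ x → ∑ A (w x))
    AB = ∑ A (λ x → ∑ B (w x))
    BB = ∑ B (λ x → ∑ B (w x))
    double : ∀ a b c → a + b + (b + c) ≡ a + 2 * b + c
    double = solve-∀

∑-indicator : ∀ (t : X → Bool) xs → ∑ xs (λ x → ⟦ t x ⟧) ≡ length (filterᵇ t xs)
∑-indicator t []       = refl
∑-indicator t (x ∷ xs) with t x
... | true  = cong suc (∑-indicator t xs)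
... | false = ∑-indicator t xs

length-filter : ∀ (t : X → Bool) xs →
                length xs ≡ length (filterᵇ t xs) + length (filterᵇ (not ∘ t) xs)
length-filter t []       = refl
length-filter t (x ∷ xs) with t x
... | true  = cong suc (length-filter t xs)
... | false = trans (cong suc (length-filter t xs)) (sym (+-suc _ _))

All-filter : ∀ (t : X → Bool) xs → All (λ x → t x ≡ true) (filterᵇ t xs)
All-filter t []       = []
All-filter t (x ∷ xs) with t x in eq
... | true  = eq ∷ All-filter t xs
... | false = All-filter t xs

-- The witness is a maximiser of `f`. The head `x` is a separate argument because an empty list
-- offers no witness.
exists-≥-average : ∀ (f : X → ℕ) x xs → ∃ λ y → ∑ (x ∷ xs) f ≤ length (x ∷ xs) * f y
exists-≥-average f x []        = x , ≤-refl
exists-≥-average f x (x′ ∷ xs) with exists-≥-average f x′ xs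
... | y , le with ≤-total (f x) (f y)
...   | inj₁ fx≤fy = y , +-mono-≤ fx≤fy le
...   | inj₂ fy≤fx = x , +-monoʳ-≤ (f x) (≤-trans le (*-monoʳ-≤ (length (x′ ∷ xs)) fy≤fx))

∈⇒↭-∷ : ∀ {x : X} {xs} → x ∈ xs → ∃ λ xs′ → xs ↭ x ∷ xs′
∈⇒↭-∷ {x = x} x∈xs with ∈-∃++ x∈xs
... | ys , zs , refl = _ , shift x ys zs

-- Multigraphs with restricted double edges

-- In the application `w` adds the indicators of the links of `v` and `b`, and `P a` says that `a`
-- is adjacent to `b` in the link of `v`. Pairs of weight 2 are the double edges.
module Weighted
  {V : Set} (w : V → V → ℕ) (P : V → Set)
  (w-sym : ∀ x y → w x y ≡ w y x)
  (w-loop : ∀ x → w x x ≡ 0)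
  (w≤2 : ∀ x y → w x y ≤ 2)
  (apex : ∀ {a} → P a → ∀ c d → w c d ≡ 2 → w c a + w d a ≤ 2)
  where

  between : List V → List V → ℕ
  between xs ys = ∑ xs λ x → ∑ ys (w x)

  -- Twice the number of edges, with multiplicity, of the multigraph on the disjoint union of `A`
  -- and `B`.
  total : List V → List V → ℕ
  total A B = between A A + 2 * between A B + between B B

  between-↭ : ∀ {xs xs′ ys ys′} → xs ↭ xs′ → ys ↭ ys′ → between xs ys ≡ between xs′ ys′
  between-↭ {xs} p q = trans (∑-cong xs (λ x → ∑-↭ (w x) q)) (∑-↭ _ p)

  total-↭ : ∀ {A A′ B B′} → A ↭ A′ → B ↭ B′ → total A B ≡ total A′ B′
  total-↭ p q =
    cong₂ _+_ (cong₂ (λ s t → s + 2 * t) (between-↭ p p) (between-↭ p q)) (between-↭ q q)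

  between-∷ʳ : ∀ xs y ys → between xs (y ∷ ys) ≡ ∑ xs (w y) + between xs ys
  between-∷ʳ xs y ys =
    trans (∑-+ xs (λ x → w x y) (λ x → ∑ ys (w x)))
          (cong (_+ between xs ys) (∑-cong xs (λ x → w-sym x y)))

  between-∷-∷ : ∀ x xs → between (x ∷ xs) (x ∷ xs) ≡ 2 * ∑ xs (w x) + between xs xs
  between-∷-∷ x xs rewrite between-∷ʳ xs x xs | w-loop x = double (∑ xs (w x)) (between xs xs)
    where
      double : ∀ a b → a + (a + b) ≡ 2 * a + b
      double = solve-∀

  total-∷ˡ : ∀ a A B → total (a ∷ A) B ≡ total A B + 2 * (∑ A (w a) + ∑ B (w a))
  total-∷ˡ a A B rewrite between-∷-∷ a A =
    rearrange (∑ A (w a)) (between A A) (∑ B (w a)) (between A B) (between B B)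
    where
      rearrange : ∀ s t u v z →
        2 * s + t + 2 * (u + v) + z ≡ t + 2 * v + z + 2 * (s + u)
      rearrange = solve-∀

  total-∷ʳ : ∀ A b B → total A (b ∷ B) ≡ total A B + 2 * (∑ A (w b) + ∑ B (w b))
  total-∷ʳ A b B rewrite between-∷-∷ b B | between-∷ʳ A b B =
    rearrange (∑ A (w b)) (∑ B (w b)) (between A A) (between A B) (between B B)
    where
      rearrange : ∀ s t u v z →
        u + 2 * (s + v) + (2 * t + z) ≡ u + 2 * v + z + 2 * (s + t)
      rearrange = solve-∀

  -- Finding and removing double edges

  AllSingle : List V → List V → Set
  AllSingle xs ys = All (λ x → All (λ y → w x y ≤ 1) ys) xs

  Double : List V → List V → Set
  Double xs ys = ∃ λ x → ∃ λ y → x ∈ xs × y ∈ ys × w x y ≡ 2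

  single-or-double : ∀ xs ys → AllSingle xs ys ⊎ Double xs ys
  single-or-double xs ys with All.all? (λ x → All.all? (λ y → w x y ≤? 1) ys) xs
  ... | yes single = inj₁ single
  ... | no ¬single with find (¬All⇒Any¬ (λ x → All.all? (λ y → w x y ≤? 1) ys) xs ¬single)
  ...   | x , x∈xs , ¬x with find (¬All⇒Any¬ (λ y → w x y ≤? 1) ys ¬x)
  ...     | y , y∈ys , w≰1 = inj₂ (x , y , x∈xs , y∈ys , ≤-antisym (w≤2 x y) (≰⇒> w≰1))

  single-↭ : ∀ {xs xs′ ys ys′} → xs ↭ xs′ → ys ↭ ys′ → AllSingle xs ys → AllSingle xs′ ys′
  single-↭ p q = All.map (All-resp-↭ q) ∘ All-resp-↭ p

  -- Loops have weight 0, so `c` and `d` differ and can be moved to the front one after the other.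
  extract₂ : ∀ {xs c d} → c ∈ xs → d ∈ xs → w c d ≡ 2 → ∃ λ ys → xs ↭ c ∷ d ∷ ys
  extract₂ {c = c} c∈xs d∈xs eq with ∈⇒↭-∷ c∈xs
  ... | ys , p with ∈-resp-↭ p d∈xs
  ...   | here refl with () ← trans (sym (w-loop c)) eq
  ...   | there d∈ys with ∈⇒↭-∷ d∈ys
  ...     | zs , q = zs , ↭-trans p (prep c q)

  between-single : ∀ {xs ys} → AllSingle xs ys → between xs ys ≤ length xs * length ys
  between-single {ys = ys} single =
    ∑-≤-const (All.map (λ s → ≤-trans (∑-≤-const s) (≤-reflexive (*-identityʳ _))) single)

  apex-∑ : ∀ {A} → All P A → ∀ c d → w c d ≡ 2 → ∑ A (w c) + ∑ A (w d) ≤ length A * 2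
  apex-∑ {A} PA c d eq =
    ≤-trans (≤-reflexive (sym (∑-+ A (w c) (w d)))) (∑-≤-const (All.map (λ Pa → apex Pa c d eq) PA))

  ∑≤2 : ∀ xs x → ∑ xs (w x) ≤ length xs * 2
  ∑≤2 xs x = ∑-≤-const (All.universal (w≤2 x) xs)

  ∑≤1 : ∀ {xs x} → All (λ y → w x y ≤ 1) xs → ∑ xs (w x) ≤ length xs * 1
  ∑≤1 = ∑-≤-const

  -- This is (p + q)² + q², that is n² + |B|².
  bound : ℕ → ℕ → ℕ
  bound p q = p * p + 2 * p * q + 2 * (q * q)

  Bounded : List V → List V → Set
  Bounded A B = total A B ≤ bound (length A) (length B)

  Bounded-↭ : ∀ {A A′ B B′} → A ↭ A′ → B ↭ B′ → Bounded A′ B′ → Bounded A B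
  Bounded-↭ p q le =
    ≤-trans (≤-reflexive (total-↭ p q))
      (≤-trans le (≤-reflexive (sym (cong₂ bound (↭-length p) (↭-length q)))))

  -- By `apex`, `c` and `d` together send at most 2p to `A`; towards `B` the trivial weight 2 per
  -- pair is enough, and the bound grows by 4 more than needed.
  step-BB : ∀ {A c d B} → All P A → w c d ≡ 2 → Bounded A B → Bounded A (c ∷ d ∷ B)
  step-BB {A} {c} {d} {B} PA eq ih = begin
    total A (c ∷ d ∷ B)
      ≡⟨ trans (total-∷ʳ A c (d ∷ B))
               (cong₂ (λ s t → s + 2 * (∑ A (w c) + (t + ∑ B (w c)))) (total-∷ʳ A d B) eq) ⟩
    total A B + 2 * (∑ A (w d) + ∑ B (w d)) + 2 * (∑ A (w c) + (2 + ∑ B (w c)))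
      ≡⟨ regroup (total A B) (∑ A (w c)) (∑ A (w d)) (∑ B (w c)) (∑ B (w d)) ⟩
    total A B + 2 * ((∑ A (w c) + ∑ A (w d)) + (∑ B (w c) + ∑ B (w d)) + 2)
      ≤⟨ +-mono-≤ ih (*-monoʳ-≤ 2 (+-monoˡ-≤ 2 (+-mono-≤ (apex-∑ PA c d eq) (+-mono-≤ (∑≤2 B c) (∑≤2 B d))))) ⟩
    bound p q + 2 * (p * 2 + (q * 2 + q * 2) + 2)
      ≤⟨ m≤m+n _ 4 ⟩
    bound p q + 2 * (p * 2 + (q * 2 + q * 2) + 2) + 4
      ≡⟨ complete p q ⟩
    bound p (2 + q) ∎
    where
      open ≤-Reasoning
      p = length A
      q = length B
      regroup : ∀ t ac ad bc bd →
        t + 2 * (ad + bd) + 2 * (ac + (2 + bc)) ≡ t + 2 * ((ac + ad) + (bc + bd) + 2)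
      regroup = solve-∀
      complete : ∀ p q →
        p * p + 2 * p * q + 2 * (q * q) + 2 * (p * 2 + (q * 2 + q * 2) + 2) + 4
          ≡ p * p + 2 * p * (2 + q) + 2 * ((2 + q) * (2 + q))
      complete = solve-∀

  -- Here the bound grows by only 6q in the terms linear in q, so one of the two ends must send at
  -- most q to `B`. That end is `b`, since no double edge is left inside `B`.
  step-AB : ∀ {a A b B} → All P A → AllSingle (b ∷ B) (b ∷ B) → w a b ≡ 2 →
            Bounded A B → Bounded (a ∷ A) (b ∷ B)
  step-AB {a} {A} {b} {B} PA ((_ ∷ bB) ∷ _) eq ih = begin
    total (a ∷ A) (b ∷ B)
      ≡⟨ trans (total-∷ˡ a A (b ∷ B))
               (cong₂ (λ s t → s + 2 * (∑ A (w a) + (t + ∑ B (w a)))) (total-∷ʳ A b B) eq) ⟩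
    total A B + 2 * (∑ A (w b) + ∑ B (w b)) + 2 * (∑ A (w a) + (2 + ∑ B (w a)))
      ≡⟨ regroup (total A B) (∑ A (w a)) (∑ A (w b)) (∑ B (w a)) (∑ B (w b)) ⟩
    total A B + 2 * ((∑ A (w a) + ∑ A (w b)) + (∑ B (w a) + ∑ B (w b)) + 2)
      ≤⟨ +-mono-≤ ih (*-monoʳ-≤ 2 (+-monoˡ-≤ 2 (+-mono-≤ (apex-∑ PA a b eq) (+-mono-≤ (∑≤2 B a) (∑≤1 bB))))) ⟩
    bound p q + 2 * (p * 2 + (q * 2 + q * 1) + 2)
      ≤⟨ m≤m+n _ 1 ⟩
    bound p q + 2 * (p * 2 + (q * 2 + q * 1) + 2) + 1
      ≡⟨ complete p q ⟩
    bound (1 + p) (1 + q) ∎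
    where
      open ≤-Reasoning
      p = length A
      q = length B
      regroup : ∀ t aa ab ba bb →
        t + 2 * (ab + bb) + 2 * (aa + (2 + ba)) ≡ t + 2 * ((aa + ab) + (ba + bb) + 2)
      regroup = solve-∀
      complete : ∀ p q →
        p * p + 2 * p * q + 2 * (q * q) + 2 * (p * 2 + (q * 2 + q * 1) + 2) + 1
          ≡ (1 + p) * (1 + p) + 2 * (1 + p) * (1 + q) + 2 * ((1 + q) * (1 + q))
      complete = solve-∀

  -- With only single edges from `c` and `d` to `B`, the estimate matches the growth of the bound
  -- exactly.
  step-AA : ∀ {c d A B} → All P A → AllSingle (c ∷ d ∷ A) B → w c d ≡ 2 →
            Bounded A B → Bounded (c ∷ d ∷ A) B
  step-AA {c} {d} {A} {B} PA (cB ∷ dB ∷ _) eq ih = begin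
    total (c ∷ d ∷ A) B
      ≡⟨ trans (total-∷ˡ c (d ∷ A) B)
               (cong₂ (λ s t → s + 2 * (t + ∑ A (w c) + ∑ B (w c))) (total-∷ˡ d A B) eq) ⟩
    total A B + 2 * (∑ A (w d) + ∑ B (w d)) + 2 * (2 + ∑ A (w c) + ∑ B (w c))
      ≡⟨ regroup (total A B) (∑ A (w c)) (∑ A (w d)) (∑ B (w c)) (∑ B (w d)) ⟩
    total A B + 2 * ((∑ A (w c) + ∑ A (w d)) + (∑ B (w c) + ∑ B (w d)) + 2)
      ≤⟨ +-mono-≤ ih (*-monoʳ-≤ 2 (+-monoˡ-≤ 2 (+-mono-≤ (apex-∑ PA c d eq) (+-mono-≤ (∑≤1 cB) (∑≤1 dB))))) ⟩
    bound p q + 2 * (p * 2 + (q * 1 + q * 1) + 2)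
      ≡⟨ complete p q ⟩
    bound (2 + p) q ∎
    where
      open ≤-Reasoning
      p = length A
      q = length B
      regroup : ∀ t ac ad bc bd →
        t + 2 * (ad + bd) + 2 * (2 + ac + bc) ≡ t + 2 * ((ac + ad) + (bc + bd) + 2)
      regroup = solve-∀
      complete : ∀ p q →
        p * p + 2 * p * q + 2 * (q * q) + 2 * (p * 2 + (q * 1 + q * 1) + 2)
          ≡ (2 + p) * (2 + p) + 2 * (2 + p) * q + 2 * (q * q)
      complete = solve-∀

  all-single-Bounded : ∀ {A B} → AllSingle A A → AllSingle A B → AllSingle B B → Bounded A B
  all-single-Bounded {A} {B} aa ab bb =
    +-mono-≤ (+-mono-≤ (between-single aa)
                       (≤-trans (*-monoʳ-≤ 2 (between-single ab)) (≤-reflexive (sym (*-assoc 2 (length A) _)))))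
             (≤-trans (between-single bb) (m≤m+n _ _))

  -- Double pairs are removed inside B first, then between A and B, then inside A: each removal
  -- needs the preceding kind to be exhausted.
  total-bounded-by-size : ∀ n A B → length A + length B ≤ n → All P A → Bounded A B
  total-bounded-by-size n A B size PA with single-or-double B B
  total-bounded-by-size n A B size PA | inj₂ (c , d , c∈B , d∈B , eq)
    with extract₂ c∈B d∈B eq
  ... | B′ , q = Bounded-↭ (↭-refl {x = A}) q (step-BB {B = B′} PA eq
    (recur n (subst (λ k → length A + k ≤ n) (↭-length q) size)))
    where
      recur : ∀ n → length A + suc (suc (length B′)) ≤ n → Bounded A B′
      recur zero    le with () ← ≤-trans (≤-reflexive (sym (+-suc (length A) _))) le
      recur (suc n) le =
        total-bounded-by-size n A B′
          (≤-trans (+-monoʳ-≤ (length A) (n≤1+n _))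
                   (≤-pred (≤-trans (≤-reflexive (sym (+-suc (length A) _))) le))) PA
  total-bounded-by-size n A B size PA | inj₁ bb with single-or-double A B
  total-bounded-by-size n A B size PA | inj₁ bb | inj₂ (a , b , a∈A , b∈B , eq)
    with ∈⇒↭-∷ a∈A | ∈⇒↭-∷ b∈B
  ... | A′ , p | B′ , q =
    Bounded-↭ p q (step-AB PA′ (single-↭ q q bb) eq
      (recur n (subst₂ (λ k l → k + l ≤ n) (↭-length p) (↭-length q) size)))
    where
      PA′ = All.tail (All-resp-↭ p PA)
      recur : ∀ n → suc (length A′) + suc (length B′) ≤ n → Bounded A′ B′
      recur (suc n) (s≤s le) =
        total-bounded-by-size n A′ B′ (≤-trans (+-monoʳ-≤ (length A′) (n≤1+n _)) le) PA′
  total-bounded-by-size n A B size PA | inj₁ bb | inj₁ ab with single-or-double A A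
  ... | inj₁ aa = all-single-Bounded aa ab bb
  ... | inj₂ (c , d , c∈A , d∈A , eq) with extract₂ c∈A d∈A eq
  ...   | A′ , p =
    Bounded-↭ p (↭-refl {x = B}) (step-AA {B = B} PA′ (single-↭ p ↭-refl ab) eq
      (recur n (subst (λ k → k + length B ≤ n) (↭-length p) size)))
    where
      PA′ = All.tail (All.tail (All-resp-↭ p PA))
      recur : ∀ n → suc (suc (length A′)) + length B ≤ n → Bounded A′ B
      recur (suc n) (s≤s le) = total-bounded-by-size n A′ B (≤-trans (n≤1+n _) le) PA′

  -- The fuel |A| + |B| suffices: each removal deletes two vertices and uses one unit.
  total-bounded : ∀ {A} B → All P A → Bounded A B
  total-bounded {A} B = total-bounded-by-size _ A B ≤-refl

-- Degrees and tight cycles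

edge-loop₂₃ : ∀ (G : ThreeGraph n) v a → edge G v a a ≡ false
edge-loop₂₃ G v a = trans (sym₁₂ G v a a) (trans (sym₂₃ G a v a) (irrefl G a v))

orderedDeg : ThreeGraph n → Fin n → ℕ
orderedDeg {n} G v = ∑ (allFin n) λ a → ∑ (allFin n) λ b → ⟦ edge G v a b ⟧

-- Off the diagonal exactly one of `(a , b)` and `(b , a)` is increasing, and the diagonal
-- contributes nothing; `split` records this and `∑-swap` identifies the two halves.
orderedDeg≡2*deg : ∀ (G : ThreeGraph n) v → orderedDeg G v ≡ 2 * deg G v
orderedDeg≡2*deg {n} G v = begin
  orderedDeg G v
    ≡⟨ ∑-cong V (λ a → ∑-cong V (split a)) ⟩
  ∑ V (λ a → ∑ V (λ b → up a b + up b a))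
    ≡⟨ ∑-cong V (λ a → ∑-+ V (up a) (λ b → up b a)) ⟩
  ∑ V (λ a → ∑ V (up a) + ∑ V (λ b → up b a))
    ≡⟨ ∑-+ V _ _ ⟩
  deg G v + ∑ V (λ a → ∑ V (λ b → up b a))
    ≡⟨ cong (deg G v +_) (sym (∑-swap V V up)) ⟩
  deg G v + deg G v
    ≡⟨ cong (deg G v +_) (sym (+-identityʳ _)) ⟩
  2 * deg G v ∎
  where
    open ≡-Reasoning
    V = allFin n
    up : Fin n → Fin n → ℕ
    up a b = if (toℕ a <ᵇ toℕ b) ∧ edge G v a b then 1 else 0

    trichotomy : ∀ x y → x ≡ y ⊎ ((x <ᵇ y) ≡ true × (y <ᵇ x) ≡ false) ⊎ ((x <ᵇ y) ≡ false × (y <ᵇ x) ≡ true)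
    trichotomy zero    zero    = inj₁ refl
    trichotomy zero    (suc y) = inj₂ (inj₁ (refl , refl))
    trichotomy (suc x) zero    = inj₂ (inj₂ (refl , refl))
    trichotomy (suc x) (suc y) with trichotomy x y
    ... | inj₁ eq = inj₁ (cong suc eq)
    ... | inj₂ p  = inj₂ p

    split : ∀ a b → ⟦ edge G v a b ⟧ ≡ up a b + up b a
    split a b with trichotomy (toℕ a) (toℕ b)
    ... | inj₁ eq with refl ← toℕ-injective eq
                  rewrite edge-loop₂₃ G v a | Bool.∧-zeroʳ (toℕ a <ᵇ toℕ a) = refl
    ... | inj₂ (inj₁ (lt , ge)) rewrite lt | ge = sym (+-identityʳ _)
    ... | inj₂ (inj₂ (ge , lt)) rewrite lt | ge | sym₂₃ G v a b = refl

foldr-⊓-≤ : ∀ e {x} {xs : List ℕ} → x ∈ xs → foldr _⊓_ e xs ≤ x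
foldr-⊓-≤ e (here refl)           = m⊓n≤m _ _
foldr-⊓-≤ e {xs = y ∷ _} (there x∈xs) = ≤-trans (m⊓n≤n y _) (foldr-⊓-≤ e x∈xs)

δ₁≤deg : ∀ (G : ThreeGraph (suc m)) v → δ₁ G ≤ deg G v
δ₁≤deg G v = foldr-⊓-≤ _ (∈-map⁺ (deg G) (∈-allFin v))

2*[nC2]≡n*[n∸1] : ∀ n → 2 * (n C 2) ≡ n * (n ∸ 1)
2*[nC2]≡n*[n∸1] zero    = refl
2*[nC2]≡n*[n∸1] (suc n) = begin
  2 * (suc n C 2)         ≡⟨ cong (2 *_) (sym (nCk+nC[k+1]≡[n+1]C[k+1] n 1)) ⟩
  2 * (n C 1 + n C 2)     ≡⟨ *-distribˡ-+ 2 (n C 1) (n C 2) ⟩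
  2 * (n C 1) + 2 * (n C 2) ≡⟨ cong₂ (λ s t → 2 * s + t) (nC1≡n n) (2*[nC2]≡n*[n∸1] n) ⟩
  2 * n + n * (n ∸ 1)     ≡⟨ arith n ⟩
  suc n * n               ∎
  where
    open ≡-Reasoning
    arith : ∀ n → 2 * n + n * (n ∸ 1) ≡ suc n * n
    arith zero    = refl
    arith (suc n) = poly n
      where
        poly : ∀ n → 2 * (1 + n) + (1 + n) * n ≡ (2 + n) * (1 + n)
        poly = solve-∀

-- The cyclic order is `v a b c d`. The argument `b` comes early because `v` and `b` are fixed
-- before `a`, `c`, `d` are sought.
CompletesC5 : ThreeGraph n → (v b a c d : Fin n) → Set
CompletesC5 G v b a c d =
  edge G v a b ≡ true × edge G a b c ≡ true × edge G b c d ≡ true ×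
  edge G c d v ≡ true × edge G d v a ≡ true

completesC5? : ∀ (G : ThreeGraph n) v b → Dec (∃ λ a → ∃ λ c → ∃ λ d → CompletesC5 G v b a c d)
completesC5? G v b = any? λ a → any? λ c → any? λ d →
  (edge G v a b Bool.≟ true) ×-dec (edge G a b c Bool.≟ true) ×-dec (edge G b c d Bool.≟ true) ×-dec
  (edge G c d v Bool.≟ true) ×-dec (edge G d v a Bool.≟ true)

edge⇒distinct : ∀ (G : ThreeGraph n) {a b c} → edge G a b c ≡ true → a ≢ b × b ≢ c × a ≢ c
edge⇒distinct G {a} {b} {c} e =
  (λ { refl → absurd e (irrefl G a c) }) ,
  (λ { refl → absurd e (edge-loop₂₃ G a b) }) ,
  (λ { refl → absurd e (trans (sym₂₃ G a b a) (irrefl G a b)) })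
  where
    absurd : ∀ {t} → t ≡ true → t ≢ false
    absurd refl ()

-- Any two of the five vertices of a tight 5-cycle share an edge, so injectivity follows from the
-- edges themselves.
completesC5⇒copy : ∀ (G : ThreeGraph n) {v b a c d} → CompletesC5 G v b a c d →
                   Σ (Fin 5 → Fin n) λ f → IsC5Copy G f × ∃ λ i → f i ≡ v
completesC5⇒copy G {v} {b} {a} {c} {d} (vab , abc , bcd , cdv , dva)
  with edge⇒distinct G vab | edge⇒distinct G abc | edge⇒distinct G bcd
     | edge⇒distinct G cdv | edge⇒distinct G dva
... | v≢a , a≢b , v≢b | _ , b≢c , a≢c | _ , c≢d , b≢d | _ , d≢v , c≢v | _ , _ , d≢a =
  lookup vs , (lookup-injective distinct _ _ , vab , abc , bcd , cdv , dva) , c0 , refl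
  where
    vs = v ∷ a ∷ b ∷ c ∷ d ∷ []
    distinct = (v≢a ∷ v≢b ∷ ≢-sym c≢v ∷ ≢-sym d≢v ∷ [])
             ∷ (a≢b ∷ a≢c ∷ ≢-sym d≢a ∷ []) ∷ (b≢c ∷ b≢d ∷ []) ∷ (c≢d ∷ []) ∷ [] ∷ []

-- The links of two vertices as one multigraph

linkDeg : ThreeGraph n → Fin n → Fin n → ℕ
linkDeg {n} G v b = ∑ (allFin n) λ a → ⟦ edge G v b a ⟧

length-allFin : ∀ n → length (allFin n) ≡ n
length-allFin n = length-tabulate {n = n} (λ i → i)

-- `total-bounded` applied to the sum of the two links, with `A` the common neighbourhood of `v` and
-- `b` and q the size of its complement.
sum-of-two-degrees : ∀ (G : ThreeGraph n) v b →
  ¬ (∃ λ a → ∃ λ c → ∃ λ d → CompletesC5 G v b a c d) →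
  let p = linkDeg G v b in
  ∃ λ q → p + q ≡ n × orderedDeg G v + orderedDeg G b ≤ p * p + 2 * p * q + 2 * (q * q)
sum-of-two-degrees {n} G v b none =
  length B ,
  trans (cong (_+ length B) p≡) (trans (sym (length-filter t V)) (length-allFin n)) ,
  subst (λ p → orderedDeg G v + orderedDeg G b ≤ p * p + 2 * p * length B + 2 * (length B * length B))
    (sym p≡)
    (≤-trans (≤-reflexive sum≡) (total-bounded B (All-filter t V)))
  where
    V = allFin n
    t : Fin n → Bool
    t a = edge G v b a
    A = filterᵇ t V
    B = filterᵇ (not ∘ t) V
    p≡ : linkDeg G v b ≡ length A
    p≡ = ∑-indicator t V

    w : Fin n → Fin n → ℕ
    w x y = ⟦ edge G v x y ⟧ + ⟦ edge G b x y ⟧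

    w-sym : ∀ x y → w x y ≡ w y x
    w-sym x y = cong₂ (λ s t → ⟦ s ⟧ + ⟦ t ⟧) (sym₂₃ G v x y) (sym₂₃ G b x y)

    w-loop : ∀ x → w x x ≡ 0
    w-loop x rewrite edge-loop₂₃ G v x | edge-loop₂₃ G b x = refl

    ⟦⟧+⟦⟧≤2 : ∀ s t → ⟦ s ⟧ + ⟦ t ⟧ ≤ 2
    ⟦⟧+⟦⟧≤2 false false = z≤n
    ⟦⟧+⟦⟧≤2 false true  = s≤s z≤n
    ⟦⟧+⟦⟧≤2 true  false = s≤s z≤n
    ⟦⟧+⟦⟧≤2 true  true  = ≤-refl

    both : ∀ s t → ⟦ s ⟧ + ⟦ t ⟧ ≡ 2 → s ≡ true × t ≡ true
    both true true _ = refl , refl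
    both true false ()
    both false true ()
    both false false ()

    -- Three true values among four would fill one of the complementary pairs `s`, `t′` and `t`,
    -- `s′`.
    no-crossing : ∀ s t s′ t′ → ¬ (s ≡ true × t′ ≡ true) → ¬ (t ≡ true × s′ ≡ true) →
                  ⟦ s ⟧ + ⟦ t ⟧ + (⟦ s′ ⟧ + ⟦ t′ ⟧) ≤ 2
    no-crossing true  t     s′    true  ¬1 ¬2 = contradiction (refl , refl) ¬1
    no-crossing s     true  true  t′    ¬1 ¬2 = contradiction (refl , refl) ¬2
    no-crossing false false s′    t′    ¬1 ¬2 = ⟦⟧+⟦⟧≤2 s′ t′
    no-crossing false true  false false ¬1 ¬2 = s≤s z≤n
    no-crossing false true  false true  ¬1 ¬2 = ≤-refl
    no-crossing true  false false false ¬1 ¬2 = s≤s z≤n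
    no-crossing true  false true  false ¬1 ¬2 = ≤-refl
    no-crossing true  true  false false ¬1 ¬2 = ≤-refl

    -- A double edge `cd` can be traversed both ways: `vca` with `bda` closes the cycle `v a b d c`,
    -- and `bca` with `vda` closes `v a b c d`.
    apex : ∀ {a} → t a ≡ true → ∀ c d → w c d ≡ 2 → w c a + w d a ≤ 2
    apex {a} vba c d eq with both (edge G v c d) (edge G b c d) eq
    ... | vcd , bcd = no-crossing _ _ _ _
      (λ { (vca , bda) → none (a , d , c ,
          crossing (trans (sym₂₃ G v d c) vcd) (trans (sym₂₃ G b d c) bcd) bda vca) })
      (λ { (bca , vda) → none (a , c , d , crossing vcd bcd bca vda) })
      where
        crossing : ∀ {c d} → edge G v c d ≡ true → edge G b c d ≡ true →
                   edge G b c a ≡ true → edge G v d a ≡ true → CompletesC5 G v b a c d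
        crossing {c} {d} vcd bcd bca vda =
          trans (sym₂₃ G v a b) vba ,
          trans (sym₁₂ G a b c) (trans (sym₂₃ G b a c) bca) ,
          bcd ,
          trans (sym₂₃ G c d v) (trans (sym₁₂ G c v d) vcd) ,
          trans (sym₁₂ G d v a) vda

    open Weighted w (λ a → t a ≡ true) w-sym w-loop (λ x y → ⟦⟧+⟦⟧≤2 (edge G v x y) (edge G b x y)) apex

    sum≡ : orderedDeg G v + orderedDeg G b ≡ total A B
    sum≡ = trans (sym (∑∑-+ V V _ _)) (∑∑-filter w w-sym t V)

-- Upper bound

m*[m∸1]≡ : ∀ m → m * (m ∸ 1) + (3 * m + 1) ≡ suc m * suc m
m*[m∸1]≡ zero    = refl
m*[m∸1]≡ (suc m) = poly m
  where
    poly : ∀ m → (1 + m) * m + (3 * (1 + m) + 1) ≡ (2 + m) * (2 + m)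
    poly = solve-∀

-- With N = n² and y = N - D, the first hypotheses give nq ≤ y. Multiplying the last one by N yields
-- 2ND ≤ N² + y², and adding 2Ny completes the square. Note that N + y = 2N - D.
square-bound : ∀ {n p q D} → p + q ≡ n → D ≤ n * p →
  D + D ≤ p * p + 2 * p * q + 2 * (q * q) →
  ∃ λ y → D + y ≡ n * n × 2 * ((n * n) * (n * n)) ≤ (n * n + y) * (n * n + y)
square-bound {n} {p} {q} {D} refl D≤np 2D≤ =
  y , D+y≡N , +-cancelˡ-≤ (2 * (N * D)) _ _ (begin
    2 * (N * D) + 2 * (N * N)
      ≡⟨ cong (λ s → 2 * (N * D) + 2 * (N * s)) (sym D+y≡N) ⟩
    2 * (N * D) + 2 * (N * (D + y))
      ≡⟨ regroup N D y ⟩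
    N * (D + D) + (2 * (N * D) + 2 * (N * y))
      ≤⟨ +-monoˡ-≤ _ (*-monoʳ-≤ N 2D≤) ⟩
    N * (p * p + 2 * p * q + 2 * (q * q)) + (2 * (N * D) + 2 * (N * y))
      ≡⟨ cong (_+ (2 * (N * D) + 2 * (N * y))) (expand p q) ⟩
    N * N + (n * q) * (n * q) + (2 * (N * D) + 2 * (N * y))
      ≤⟨ +-monoˡ-≤ _ (+-monoʳ-≤ (N * N) (*-mono-≤ nq≤y nq≤y)) ⟩
    N * N + y * y + (2 * (N * D) + 2 * (N * y))
      ≡⟨ collect N D y ⟩
    2 * (N * D) + (N + y) * (N + y) ∎)
  where
    open ≤-Reasoning
    N = n * n
    np+nq≡N : n * p + n * q ≡ N
    np+nq≡N = sym (*-distribˡ-+ n p q)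
    D≤N : D ≤ N
    D≤N = ≤-trans D≤np (≤-trans (m≤m+n _ _) (≤-reflexive np+nq≡N))
    y = N ∸ D
    D+y≡N : D + y ≡ N
    D+y≡N = m+[n∸m]≡n D≤N
    nq≤y : n * q ≤ y
    nq≤y = +-cancelˡ-≤ D _ _ (≤-trans (+-monoˡ-≤ _ D≤np) (≤-reflexive (trans np+nq≡N (sym D+y≡N))))
    regroup : ∀ N D y → 2 * (N * D) + 2 * (N * (D + y)) ≡ N * (D + D) + (2 * (N * D) + 2 * (N * y))
    regroup = solve-∀
    expand : ∀ p q → (p + q) * (p + q) * (p * p + 2 * p * q + 2 * (q * q))
      ≡ (p + q) * (p + q) * ((p + q) * (p + q)) + ((p + q) * q) * ((p + q) * q)
    expand = solve-∀
    collect : ∀ N D y → N * N + y * y + (2 * (N * D) + 2 * (N * y)) ≡ 2 * (N * D) + (N + y) * (N + y)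
    collect = solve-∀

-- The part 2ru + u² dominates the lower-order terms after squaring, where `u * n₁` bounds the error
-- from replacing m(m - 1) by (m + 1)². The 6 ensures N ≤ 2m(m - 1) and a strict inequality.
threshold : ℕ → ℕ → ℕ
threshold P k = 2 * r * u + u * u + 6
  where
    r = 2 * k ∸ P
    u = 3 * P

2[k*a]≡k*[2a] : ∀ k a → 2 * (k * a) ≡ k * (2 * a)
2[k*a]≡k*[2a] = solve-∀

-- A degree above the ratio P/k forces k(N + y) ≤ rN + un. Squaring and comparing with 2k²N² leaves
-- N² ≤ n³(2ru + u²), which fails for large n.
too-large-degree : ∀ P k m δ {y} →
  (2 * k ∸ P) * (2 * k ∸ P) < 2 * k * k → threshold P k ≤ suc m →
  2 * δ + y ≡ suc m * suc m →
  2 * ((suc m * suc m) * (suc m * suc m)) ≤ (suc m * suc m + y) * (suc m * suc m + y) →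
  ¬ (P * (m C 2) < k * δ)
too-large-degree P k m δ {y} r²<2k² large D+y≡N 2N²≤ Pbin<kδ = by-size (≤-total (2 * k) P)
  where
    open ≤-Reasoning
    n₁ = suc m
    N = n₁ * n₁
    r = 2 * k ∸ P
    u = 3 * P
    h = m * (m ∸ 1)

    Ph<kD : P * h < k * (2 * δ)
    Ph<kD = begin-strict
      P * h             ≡⟨ cong (P *_) (sym (2*[nC2]≡n*[n∸1] m)) ⟩
      P * (2 * (m C 2)) ≡⟨ sym (2[k*a]≡k*[2a] P (m C 2)) ⟩
      2 * (P * (m C 2)) <⟨ *-monoʳ-< 2 Pbin<kδ ⟩
      2 * (k * δ)       ≡⟨ 2[k*a]≡k*[2a] k δ ⟩
      k * (2 * δ)       ∎

    N≤2h : N ≤ 2 * h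
    N≤2h = at-least-6 m (≤-trans (m≤n+m 6 _) large)
      where
        poly : ∀ j → (6 + j) * (6 + j) + (4 + 6 * j + j * j) ≡ 2 * ((5 + j) * (4 + j))
        poly = solve-∀
        at-least-6 : ∀ m → 6 ≤ suc m → suc m * suc m ≤ 2 * (m * (m ∸ 1))
        at-least-6 .(5 + j) (s≤s (s≤s (s≤s (s≤s (s≤s (s≤s {n = j} z≤n)))))) =
          ≤-trans (m≤m+n _ _) (≤-reflexive (poly j))

    z = P * (3 * m + 1)

    z≤un : z ≤ u * n₁
    z≤un = ≤-trans (m≤m+n _ (2 * P)) (≤-reflexive (poly P m))
      where
        poly : ∀ P m → P * (3 * m + 1) + 2 * P ≡ 3 * P * (1 + m)
        poly = solve-∀

    -- When 2k ≤ P the subtraction in `r` truncates, but the trivial bound D ≤ N already contradicts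
    -- the assumption.
    by-size : 2 * k ≤ P ⊎ P ≤ 2 * k → ⊥
    by-size (inj₁ 2k≤P) = <⇒≱ Ph<kD (begin
      k * (2 * δ)       ≤⟨ *-monoʳ-≤ k (≤-trans (m≤m+n _ _) (≤-reflexive D+y≡N)) ⟩
      k * N             ≤⟨ *-monoʳ-≤ k N≤2h ⟩
      k * (2 * h)       ≡⟨ assoc k h ⟩
      2 * k * h         ≤⟨ *-monoˡ-≤ h 2k≤P ⟩
      P * h             ∎)
      where
        assoc : ∀ k h → k * (2 * h) ≡ 2 * k * h
        assoc = solve-∀
    by-size (inj₂ P≤2k) = <⇒≱ n⁴-large n⁴-small
      where
        r+P≡2k : r + P ≡ 2 * k
        r+P≡2k = m∸n+n≡m P≤2k

        k[N+y]≤ : k * (N + y) ≤ r * N + u * n₁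
        k[N+y]≤ = +-cancelˡ-≤ (k * (2 * δ)) _ _ (begin
          k * (2 * δ) + k * (N + y)      ≡⟨ gather k (2 * δ) N y ⟩
          k * (2 * δ + y) + k * N        ≡⟨ cong (λ s → k * s + k * N) D+y≡N ⟩
          k * N + k * N                  ≡⟨ twice k N ⟩
          2 * k * N                      ≡⟨ cong (_* N) (sym r+P≡2k) ⟩
          (r + P) * N                    ≡⟨ *-distribʳ-+ N r P ⟩
          r * N + P * N                  ≡⟨ cong (λ s → r * N + P * s) (sym (m*[m∸1]≡ m)) ⟩
          r * N + P * (h + (3 * m + 1))  ≡⟨ cong (r * N +_) (*-distribˡ-+ P h (3 * m + 1)) ⟩
          r * N + (P * h + z)            ≤⟨ +-monoʳ-≤ (r * N) (+-mono-≤ (<⇒≤ Ph<kD) z≤un) ⟩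
          r * N + (k * (2 * δ) + u * n₁)  ≡⟨ exchange (r * N) (k * (2 * δ)) (u * n₁) ⟩
          k * (2 * δ) + (r * N + u * n₁)  ∎)
          where
            gather : ∀ k D N y → k * D + k * (N + y) ≡ k * (D + y) + k * N
            gather = solve-∀
            twice : ∀ k N → k * N + k * N ≡ 2 * k * N
            twice = solve-∀
            exchange : ∀ a b c → a + (b + c) ≡ b + (a + c)
            exchange = solve-∀

        n⁴-small : N * N ≤ n₁ * n₁ * n₁ * (2 * r * u + u * u)
        n⁴-small = +-cancelˡ-≤ (r * r * (N * N)) _ _ (begin
          r * r * (N * N) + N * N              ≡⟨ +-comm (r * r * (N * N)) (N * N) ⟩
          -- Integrality turns r² < 2k² into a gap of at least 1, which supplies the spare `N * N`.
          suc (r * r) * (N * N)                ≤⟨ *-monoˡ-≤ (N * N) r²<2k² ⟩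
          2 * k * k * (N * N)                  ≡⟨ assoc k (N * N) ⟩
          k * k * (2 * (N * N))                ≤⟨ *-monoʳ-≤ (k * k) 2N²≤ ⟩
          k * k * ((N + y) * (N + y))          ≡⟨ square k (N + y) ⟩
          (k * (N + y)) * (k * (N + y))        ≤⟨ *-mono-≤ k[N+y]≤ k[N+y]≤ ⟩
          -- Pads u²n² to u²n³, so that n³ factors out of all lower-order terms.
          (r * N + u * n₁) * (r * N + u * n₁)    ≤⟨ m≤m+n _ (u * u * (n₁ * n₁) * m) ⟩
          (r * N + u * n₁) * (r * N + u * n₁) + u * u * (n₁ * n₁) * m
                                               ≡⟨ expand r u m ⟩
          r * r * (N * N) + n₁ * n₁ * n₁ * (2 * r * u + u * u) ∎)
          where
            assoc : ∀ k M → 2 * k * k * M ≡ k * k * (2 * M)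
            assoc = solve-∀
            square : ∀ k M → k * k * (M * M) ≡ (k * M) * (k * M)
            square = solve-∀
            expand : ∀ r u m →
              (r * ((1 + m) * (1 + m)) + u * (1 + m)) * (r * ((1 + m) * (1 + m)) + u * (1 + m))
                + u * u * ((1 + m) * (1 + m)) * m
              ≡ r * r * ((1 + m) * (1 + m) * ((1 + m) * (1 + m)))
                + (1 + m) * (1 + m) * (1 + m) * (2 * r * u + u * u)
            expand = solve-∀

        n⁴-large : n₁ * n₁ * n₁ * (2 * r * u + u * u) < N * N
        n⁴-large = begin-strict
          n₁ * n₁ * n₁ * (2 * r * u + u * u) <⟨ *-monoʳ-< (n₁ * n₁ * n₁) (≤-trans (m<m+n _ (s≤s z≤n)) large) ⟩
          n₁ * n₁ * n₁ * n₁                   ≡⟨ *-assoc (n₁ * n₁) n₁ n₁ ⟩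
          N * N                           ∎

-- If the inequality fails, a covering is constructed: the search for a cycle through `v` and a
-- chosen `b` is decidable, and its failure contradicts `too-large-degree`.
upper-bound : ∀ P k → (2 * k ∸ P) * (2 * k ∸ P) < 2 * k * k →
  ∀ m → threshold P k ≤ suc m → (G : ThreeGraph (suc m)) →
  ¬ HasC5Covering G → k * δ₁ G ≤ P * (m C 2)
upper-bound P k r²<2k² m large G uncovered with k * δ₁ G ≤? P * (m C 2)
... | yes le = le
... | no ¬le = contradiction cover uncovered
  where
    D≤ : ∀ v → 2 * δ₁ G ≤ orderedDeg G v
    D≤ v = ≤-trans (*-monoʳ-≤ 2 (δ₁≤deg G v)) (≤-reflexive (sym (orderedDeg≡2*deg G v)))

    cover : HasC5Covering G
    -- `f0` and `tabulate fsuc` are head and tail of `allFin (suc m)`. The average over `b` gives D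
    -- ≤ np.
    cover v with exists-≥-average (linkDeg G v) f0 (tabulate fsuc)
    ... | b , avg with completesC5? G v b
    ...   | yes (a , c , d , completes) = completesC5⇒copy G completes
    ...   | no none with sum-of-two-degrees G v b none
    ...     | q , p+q≡n , sum≤
      with square-bound p+q≡n
             (≤-trans (D≤ v) (≤-trans avg (≤-reflexive (cong (_* linkDeg G v b) (length-allFin (suc m))))))
             (≤-trans (+-mono-≤ (D≤ v) (D≤ b)) sum≤)
    ...       | y , D+y≡N , 2N²≤ =
      ⊥-elim (too-large-degree P k m (δ₁ G) r²<2k² large D+y≡N 2N²≤ (≰⇒> ¬le))

-- Lower bound

∑-allFin-suc : ∀ n (f : Fin (suc n) → ℕ) → ∑ (allFin (suc n)) f ≡ f f0 + ∑ (allFin n) (f ∘ fsuc)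
∑-allFin-suc n f = cong (λ l → f f0 + sum l)
  (trans (map-tabulate fsuc f) (sym (map-tabulate (λ i → i) (f ∘ fsuc))))

∑-≡ᵇ≤1 : ∀ n k → ∑ (allFin n) (λ i → ⟦ k ≡ᵇ toℕ i ⟧) ≤ 1
∑-≡ᵇ≤1 zero    k       = z≤n
∑-≡ᵇ≤1 (suc n) zero    = ≤-reflexive (trans (∑-allFin-suc n (λ i → ⟦ 0 ≡ᵇ toℕ i ⟧))
  (cong suc (trans (∑-const (allFin n) 0) (*-zeroʳ (length (allFin n))))))
∑-≡ᵇ≤1 (suc n) (suc k) =
  ≤-trans (≤-reflexive (∑-allFin-suc n (λ i → ⟦ suc k ≡ᵇ toℕ i ⟧))) (∑-≡ᵇ≤1 n k)

∑-<ᵇ : ∀ {q m} → q ≤ m → ∑ (allFin m) (λ i → ⟦ toℕ i <ᵇ q ⟧) ≡ q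
∑-<ᵇ {m = m} z≤n = trans (∑-const (allFin m) 0) (*-zeroʳ (length (allFin m)))
∑-<ᵇ {suc q} {suc m} (s≤s q≤m) =
  trans (∑-allFin-suc m (λ i → ⟦ toℕ i <ᵇ suc q ⟧)) (cong suc (∑-<ᵇ q≤m))

-- The colour pattern

data Colour : Set where
  hub red blue : Colour

-- The sum of three weights determines the multiset of colours, which makes `allowed` symmetric:
-- 1 and 2 are the mixed red-blue triples, 4 and 6 the hub with two reds or two blues.
weight : Colour → ℕ
weight red  = 0
weight blue = 1
weight hub  = 4

allowedSum : ℕ → Bool
allowedSum 1 = true
allowedSum 2 = true
allowedSum 4 = true
allowedSum 6 = true
allowedSum _ = false

allowed : Colour → Colour → Colour → Bool
allowed x y z = allowedSum (weight x + weight y + weight z)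

allowed-sym₁₂ : ∀ x y z → allowed x y z ≡ allowed y x z
allowed-sym₁₂ x y z = cong (λ s → allowedSum (s + weight z)) (+-comm (weight x) (weight y))

allowed-sym₂₃ : ∀ x y z → allowed x y z ≡ allowed x z y
allowed-sym₂₃ x y z = cong allowedSum (comm (weight x) (weight y) (weight z))
  where
    comm : ∀ a b c → a + b + c ≡ a + c + b
    comm = solve-∀

allowed-hub : ∀ {x y} → allowed hub x y ≡ true → x ≡ y
allowed-hub {red}  {red}  _ = refl
allowed-hub {blue} {blue} _ = refl
allowed-hub {red}  {blue} ()
allowed-hub {blue} {red}  ()
allowed-hub {hub}  {hub}  _ = refl
allowed-hub {hub}  {red}  ()
allowed-hub {hub}  {blue} ()
allowed-hub {red}  {hub}  ()
allowed-hub {blue} {hub}  ()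

not-monochromatic : ∀ x → allowed x x x ≢ true
not-monochromatic hub  ()
not-monochromatic red  ()
not-monochromatic blue ()

-- The three edges at `v` equate the colours of `a` and `b`, of `c` and `d`, and of `d` and `a`;
-- then `abc` would be monochromatic.
no-cycle-through-hub : ∀ v a b c d → v ≡ hub →
  allowed v a b ≡ true → allowed a b c ≡ true → allowed c d v ≡ true → allowed d v a ≡ true → ⊥
no-cycle-through-hub .hub a b c d refl vab abc cdv dva
  with refl ← allowed-hub {a} vab
     | refl ← allowed-hub {d} {c}
         (trans (allowed-sym₂₃ hub d c) (trans (allowed-sym₁₂ hub c d) (trans (allowed-sym₂₃ c hub d) cdv)))
     | refl ← allowed-hub {d} {a} (trans (allowed-sym₁₂ hub d a) dva)
  = not-monochromatic a abc

≡ᵇ-sym : ∀ x y → (x ≡ᵇ y) ≡ (y ≡ᵇ x)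
≡ᵇ-sym zero    zero    = refl
≡ᵇ-sym zero    (suc y) = refl
≡ᵇ-sym (suc x) zero    = refl
≡ᵇ-sym (suc x) (suc y) = ≡ᵇ-sym x y

≡ᵇ-refl : ∀ x → (x ≡ᵇ x) ≡ true
≡ᵇ-refl zero    = refl
≡ᵇ-refl (suc x) = ≡ᵇ-refl x

distinct : ℕ → ℕ → ℕ → Bool
distinct x y z = not (x ≡ᵇ y) ∧ (not (y ≡ᵇ z) ∧ not (x ≡ᵇ z))

distinct-sym₁₂ : ∀ x y z → distinct x y z ≡ distinct y x z
distinct-sym₁₂ x y z rewrite ≡ᵇ-sym x y =
  cong (not (y ≡ᵇ x) ∧_) (Bool.∧-comm (not (y ≡ᵇ z)) (not (x ≡ᵇ z)))

distinct-sym₂₃ : ∀ x y z → distinct x y z ≡ distinct x z y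
distinct-sym₂₃ x y z rewrite ≡ᵇ-sym y z = reverse (not (x ≡ᵇ y)) (not (z ≡ᵇ y)) (not (x ≡ᵇ z))
  where
    reverse : ∀ s t u → s ∧ (t ∧ u) ≡ u ∧ (t ∧ s)
    reverse s t u = trans (sym (Bool.∧-assoc s t u))
      (trans (Bool.∧-comm (s ∧ t) u) (cong (u ∧_) (Bool.∧-comm s t)))

isRed isBlue : Colour → ℕ
isRed red  = 1
isRed _    = 0
isBlue blue = 1
isBlue _    = 0

-- A sum of products, so that double sums factor into colour counts. Pairs containing a hub are
-- dropped.
allowed-≥ : Colour → Colour → Colour → ℕ
allowed-≥ hub  a b = isRed a * isRed b + isBlue a * isBlue b
allowed-≥ red  a b = isRed a * isBlue b + (isBlue a * isRed b + isBlue a * isBlue b)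
allowed-≥ blue a b = isRed a * isBlue b + (isBlue a * isRed b + isRed a * isRed b)

allowed-≥-≤ : ∀ x a b → allowed-≥ x a b ≤ ⟦ allowed x a b ⟧
allowed-≥-≤ hub  hub  b    = z≤n
allowed-≥-≤ hub  red  hub  = z≤n
allowed-≥-≤ hub  red  red  = ≤-refl
allowed-≥-≤ hub  red  blue = z≤n
allowed-≥-≤ hub  blue hub  = z≤n
allowed-≥-≤ hub  blue red  = z≤n
allowed-≥-≤ hub  blue blue = ≤-refl
allowed-≥-≤ red  hub  b    = z≤n
allowed-≥-≤ red  red  hub  = z≤n
allowed-≥-≤ red  red  red  = z≤n
allowed-≥-≤ red  red  blue = ≤-refl
allowed-≥-≤ red  blue hub  = z≤n
allowed-≥-≤ red  blue red  = ≤-refl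
allowed-≥-≤ red  blue blue = ≤-refl
allowed-≥-≤ blue hub  b    = z≤n
allowed-≥-≤ blue red  hub  = z≤n
allowed-≥-≤ blue red  red  = ≤-refl
allowed-≥-≤ blue red  blue = ≤-refl
allowed-≥-≤ blue blue hub  = z≤n
allowed-≥-≤ blue blue red  = ≤-refl
allowed-≥-≤ blue blue blue = z≤n

-- 3-graphs from vertex colourings

module Coloured {n : ℕ} (colour : Fin n → Colour) where

  graph : ThreeGraph n
  graph .edge a b c =
    distinct (toℕ a) (toℕ b) (toℕ c) ∧ allowed (colour a) (colour b) (colour c)
  graph .sym₁₂ a b c =
    cong₂ _∧_ (distinct-sym₁₂ (toℕ a) _ _) (allowed-sym₁₂ (colour a) _ _)
  graph .sym₂₃ a b c =
    cong₂ _∧_ (distinct-sym₂₃ (toℕ a) _ _) (allowed-sym₂₃ (colour a) (colour b) _)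
  graph .irrefl a c rewrite ≡ᵇ-refl (toℕ a) = refl

  edge⇒allowed : ∀ a b c → edge graph a b c ≡ true →
                 allowed (colour a) (colour b) (colour c) ≡ true
  edge⇒allowed a b c e with distinct (toℕ a) (toℕ b) (toℕ c)
  ... | true = e

  -- The hub may occupy any of the five positions; rotating the cycle reduces each to
  -- `no-cycle-through-hub`.
  hub-uncovered : ∀ {v} → colour v ≡ hub → ¬ HasC5Covering graph
  hub-uncovered {v} v-hub cover with cover v
  ... | f , (_ , e₀ , e₁ , e₂ , e₃ , e₄) , i , fi≡v = at i (trans (cong colour fi≡v) v-hub)
    where
      k₀ = colour (f c0)
      k₁ = colour (f c1)
      k₂ = colour (f c2)
      k₃ = colour (f c3)
      k₄ = colour (f c4)
      p₀ = edge⇒allowed (f c0) (f c1) (f c2) e₀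
      p₁ = edge⇒allowed (f c1) (f c2) (f c3) e₁
      p₂ = edge⇒allowed (f c2) (f c3) (f c4) e₂
      p₃ = edge⇒allowed (f c3) (f c4) (f c0) e₃
      p₄ = edge⇒allowed (f c4) (f c0) (f c1) e₄
      at : ∀ i → colour (f i) ≡ hub → ⊥
      at f0                             eq = no-cycle-through-hub k₀ k₁ k₂ k₃ k₄ eq p₀ p₁ p₃ p₄
      at (fsuc f0)                      eq = no-cycle-through-hub k₁ k₂ k₃ k₄ k₀ eq p₁ p₂ p₄ p₀
      at (fsuc (fsuc f0))               eq = no-cycle-through-hub k₂ k₃ k₄ k₀ k₁ eq p₂ p₃ p₀ p₁
      at (fsuc (fsuc (fsuc f0)))        eq = no-cycle-through-hub k₃ k₄ k₀ k₁ k₂ eq p₃ p₄ p₁ p₂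
      at (fsuc (fsuc (fsuc (fsuc f0)))) eq = no-cycle-through-hub k₄ k₀ k₁ k₂ k₃ eq p₄ p₀ p₂ p₃

  V = allFin n

  reds blues : ℕ
  reds  = ∑ V (isRed ∘ colour)
  blues = ∑ V (isBlue ∘ colour)

  count : Colour → ℕ
  count hub  = reds * reds + blues * blues
  count red  = reds * blues + (blues * reds + blues * blues)
  count blue = reds * blues + (blues * reds + reds * reds)

  ∑∑-allowed-≥ : ∀ x → ∑ V (λ a → ∑ V (λ b → allowed-≥ x (colour a) (colour b))) ≡ count x
  ∑∑-allowed-≥ hub  = trans (∑∑-+ V V _ _) (cong₂ _+_ (∑-product V V _ _) (∑-product V V _ _))
  ∑∑-allowed-≥ red  = trans (∑∑-+ V V _ _) (cong₂ _+_ (∑-product V V _ _)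
    (trans (∑∑-+ V V _ _) (cong₂ _+_ (∑-product V V _ _) (∑-product V V _ _))))
  ∑∑-allowed-≥ blue = trans (∑∑-+ V V _ _) (cong₂ _+_ (∑-product V V _ _)
    (trans (∑∑-+ V V _ _) (cong₂ _+_ (∑-product V V _ _) (∑-product V V _ _))))

  coincidences : ℕ → ℕ → ℕ → ℕ
  coincidences x a b = ⟦ x ≡ᵇ a ⟧ + (⟦ a ≡ᵇ b ⟧ + ⟦ x ≡ᵇ b ⟧)

  distinct-or-coincident : ∀ x a b t → ⟦ t ⟧ ≤ ⟦ distinct x a b ∧ t ⟧ + coincidences x a b
  distinct-or-coincident x a b false = z≤n
  distinct-or-coincident x a b true with x ≡ᵇ a | a ≡ᵇ b | x ≡ᵇ b
  ... | true  | _     | _     = m≤m+n 1 _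
  ... | false | true  | _     = m≤m+n 1 _
  ... | false | false | true  = ≤-refl
  ... | false | false | false = ≤-refl

  -- Each of the three equalities fixes one coordinate once the other is chosen, so it holds for at
  -- most n pairs. The first sum is swapped to bring its constrained coordinate inside.
  ∑∑-coincidences : ∀ x → ∑ V (λ a → ∑ V (λ b → coincidences x (toℕ a) (toℕ b))) ≤ n * 3
  ∑∑-coincidences x = begin
    ∑ V (λ a → ∑ V (λ b → coincidences x (toℕ a) (toℕ b)))
      ≡⟨ trans (∑∑-+ V V _ _) (cong₂ _+_ (∑-swap V V (λ a _ → ⟦ x ≡ᵇ toℕ a ⟧)) (∑∑-+ V V _ _)) ⟩
    ∑ V (λ _ → ∑ V (λ a → ⟦ x ≡ᵇ toℕ a ⟧)) +
      (∑ V (λ a → ∑ V (λ b → ⟦ toℕ a ≡ᵇ toℕ b ⟧)) + ∑ V (λ _ → ∑ V (λ b → ⟦ x ≡ᵇ toℕ b ⟧)))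
      ≤⟨ +-mono-≤ (≤n (λ _ → x)) (+-mono-≤ (≤n toℕ) (≤n (λ _ → x))) ⟩
    n + (n + n)
      ≡⟨ triple n ⟩
    n * 3 ∎
    where
      open ≤-Reasoning
      ≤n : (k : Fin (n) → ℕ) → ∑ V (λ a → ∑ V (λ b → ⟦ k a ≡ᵇ toℕ b ⟧)) ≤ n
      ≤n k = ≤-trans (∑-mono V (λ a → ∑-≡ᵇ≤1 (n) (k a)))
        (≤-reflexive (trans (∑-const V 1) (trans (*-identityʳ _) (length-allFin (n)))))
      triple : ∀ n → n + (n + n) ≡ n * 3
      triple = solve-∀

  count≤orderedDeg : ∀ x → count (colour x) ≤ orderedDeg graph x + n * 3
  count≤orderedDeg x = begin
    count (colour x)
      ≡⟨ sym (∑∑-allowed-≥ (colour x)) ⟩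
    ∑ V (λ a → ∑ V (λ b → allowed-≥ (colour x) (colour a) (colour b)))
      ≤⟨ ∑-mono V (λ a → ∑-mono V (λ b →
           ≤-trans (allowed-≥-≤ (colour x) (colour a) (colour b))
                   (distinct-or-coincident (toℕ x) (toℕ a) (toℕ b) _))) ⟩
    ∑ V (λ a → ∑ V (λ b → ⟦ edge graph x a b ⟧ + coincidences (toℕ x) (toℕ a) (toℕ b)))
      ≡⟨ ∑∑-+ V V _ _ ⟩
    orderedDeg graph x + ∑ V (λ a → ∑ V (λ b → coincidences (toℕ x) (toℕ a) (toℕ b)))
      ≤⟨ +-monoʳ-≤ (orderedDeg graph x) (∑∑-coincidences (toℕ x)) ⟩
    orderedDeg graph x + n * 3 ∎
    where open ≤-Reasoning

-- The extremal colouring and its minimum degree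

module Construction (m q : ℕ) where

  colour : Fin (suc m) → Colour
  colour f0       = hub
  colour (fsuc i) = if toℕ i <ᵇ q then blue else red

  open Coloured colour public

  blues≡q : q ≤ m → blues ≡ q
  blues≡q q≤m = trans (∑-allFin-suc m (isBlue ∘ colour)) (trans (∑-cong (allFin m) blue-suc) (∑-<ᵇ q≤m))
    where
      blue-suc : ∀ i → isBlue (colour (fsuc i)) ≡ ⟦ toℕ i <ᵇ q ⟧
      blue-suc i with toℕ i <ᵇ q
      ... | true  = refl
      ... | false = refl

  reds+blues≡m : reds + blues ≡ m
  reds+blues≡m = begin
    reds + blues
      ≡⟨ sym (∑-+ V (isRed ∘ colour) (isBlue ∘ colour)) ⟩
    ∑ V (λ a → isRed (colour a) + isBlue (colour a))
      ≡⟨ ∑-allFin-suc m (λ a → isRed (colour a) + isBlue (colour a)) ⟩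
    ∑ (allFin m) (λ i → isRed (colour (fsuc i)) + isBlue (colour (fsuc i)))
      ≡⟨ ∑-cong (allFin m) one ⟩
    ∑ (allFin m) (λ _ → 1)
      ≡⟨ trans (∑-const (allFin m) 1) (trans (*-identityʳ _) (length-allFin m)) ⟩
    m ∎
    where
      open ≡-Reasoning
      one : ∀ i → isRed (colour (fsuc i)) + isBlue (colour (fsuc i)) ≡ 1
      one i with toℕ i <ᵇ q
      ... | true  = refl
      ... | false = refl

  -- Red density 2/3 is where the links of the hub and of a red vertex have equal density 5/9; at e
  -- = 0 both identities are tight, while blue has room to spare. The remainder `e` costs 12qe +
  -- 5e².
  count-large : ∀ e → e ≤ 2 → q ≤ m → reds ≡ 2 * q + e → ∀ x →
                5 * (m * m) ≤ 9 * count x + (24 * q + 20)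
  count-large e e≤2 q≤m reds≡ x = begin
    5 * (m * m)
      ≡⟨ cong (λ s → 5 * (s * s)) (trans (sym reds+blues≡m) (cong₂ _+_ reds≡ (blues≡q q≤m))) ⟩
    5 * ((2 * q + e + q) * (2 * q + e + q))
      ≤⟨ by-colour x ⟩
    9 * count x + (12 * (q * e) + 5 * (e * e))
      ≤⟨ +-monoʳ-≤ (9 * count x)
           (+-mono-≤ (*-monoʳ-≤ 12 (*-monoʳ-≤ q e≤2)) (*-monoʳ-≤ 5 (*-mono-≤ e≤2 e≤2))) ⟩
    9 * count x + (12 * (q * 2) + 20)
      ≡⟨ cong (λ s → 9 * count x + (s + 20)) (tidy q) ⟩
    9 * count x + (24 * q + 20) ∎
    where
      open ≤-Reasoning
      tidy : ∀ q → 12 * (q * 2) ≡ 24 * q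
      tidy = solve-∀
      hub-identity : ∀ q e → 5 * ((2 * q + e + q) * (2 * q + e + q)) + (18 * (q * e) + 9 * (e * e))
        ≡ 9 * ((2 * q + e) * (2 * q + e) + q * q) + (12 * (q * e) + 5 * (e * e))
      hub-identity = solve-∀
      red-identity : ∀ q e → 5 * ((2 * q + e + q) * (2 * q + e + q))
        ≡ 9 * ((2 * q + e) * q + (q * (2 * q + e) + q * q)) + (12 * (q * e) + 5 * (e * e))
      red-identity = solve-∀
      blue-identity : ∀ q e → 5 * ((2 * q + e + q) * (2 * q + e + q))
          + (27 * (q * q) + 36 * (q * e) + 9 * (e * e))
        ≡ 9 * ((2 * q + e) * q + (q * (2 * q + e) + (2 * q + e) * (2 * q + e))) + (12 * (q * e) + 5 * (e * e))
      blue-identity = solve-∀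
      by-colour : ∀ x → 5 * ((2 * q + e + q) * (2 * q + e + q)) ≤ 9 * count x + (12 * (q * e) + 5 * (e * e))
      by-colour hub  rewrite reds≡ | blues≡q q≤m = ≤-trans (m≤m+n _ _) (≤-reflexive (hub-identity q e))
      by-colour red  rewrite reds≡ | blues≡q q≤m = ≤-reflexive (red-identity q e)
      by-colour blue rewrite reds≡ | blues≡q q≤m = ≤-trans (m≤m+n _ _) (≤-reflexive (blue-identity q e))

-- The default value of the fold is itself a degree, so the minimum is always realised by a vertex.
δ₁-attained : ∀ {m} (G : ThreeGraph (suc m)) → ∃ λ v → deg G v ≤ δ₁ G
δ₁-attained {m} G = attained (allFin (suc m))
  where
    attained : ∀ vs → ∃ λ v → deg G v ≤ foldr _⊓_ (deg G f0) (map (deg G) vs)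
    attained []       = f0 , ≤-refl
    attained (v ∷ vs) with attained vs
    ... | u , le with ⊓-sel (deg G v) (foldr _⊓_ (deg G f0) (map (deg G) vs))
    ...   | inj₁ eq = v , ≤-reflexive (sym eq)
    ...   | inj₂ eq = u , ≤-trans le (≤-reflexive (sym eq))

-- The error 35m + 47 collects 27(m + 1) from coincident vertices and 8m + 20 from rounding m/3.
min-degree-large : ∀ m → let open Construction m (m / 3) in
  5 * (m * m) ≤ 18 * δ₁ graph + (35 * m + 47)
min-degree-large m = rearrange (δ₁-attained graph)
  where
    q = m / 3
    e = m % 3
    open Construction m q
    m≡ : m ≡ (2 * q + e) + q
    m≡ = trans (m≡m%n+[m/n]*n m 3) (regroup e q)
      where
        regroup : ∀ e q → e + q * 3 ≡ 2 * q + e + q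
        regroup = solve-∀
    q≤m : q ≤ m
    q≤m = ≤-trans (m≤n+m q (2 * q + e)) (≤-reflexive (sym m≡))
    reds≡ : reds ≡ 2 * q + e
    reds≡ = +-cancelʳ-≡ q reds (2 * q + e)
      (trans (cong (reds +_) (sym (blues≡q q≤m))) (trans reds+blues≡m m≡))
    24q≤8m : 24 * q ≤ 8 * m
    24q≤8m = ≤-trans (m≤m+n _ (8 * e)) (≤-reflexive (trans (regroup q e) (cong (8 *_) (sym m≡))))
      where
        regroup : ∀ q e → 24 * q + 8 * e ≡ 8 * (2 * q + e + q)
        regroup = solve-∀
    open ≤-Reasoning
    rearrange : ∃ (λ v → deg graph v ≤ δ₁ graph) → 5 * (m * m) ≤ 18 * δ₁ graph + (35 * m + 47)
    rearrange (v , deg≤) = begin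
      5 * (m * m)
        ≤⟨ count-large e (≤-pred (m%n<n m 3)) q≤m reds≡ (colour v) ⟩
      9 * count (colour v) + (24 * q + 20)
        ≤⟨ +-mono-≤ (*-monoʳ-≤ 9 (count≤orderedDeg v)) (+-monoˡ-≤ 20 24q≤8m) ⟩
      9 * (orderedDeg graph v + suc m * 3) + (8 * m + 20)
        ≤⟨ +-monoˡ-≤ _ (*-monoʳ-≤ 9 (+-monoˡ-≤ _
             (≤-trans (≤-reflexive (orderedDeg≡2*deg graph v)) (*-monoʳ-≤ 2 deg≤)))) ⟩
      9 * (2 * δ₁ graph + suc m * 3) + (8 * m + 20)
        ≡⟨ tidy (δ₁ graph) m ⟩
      18 * δ₁ graph + (35 * m + 47) ∎
      where
        tidy : ∀ d m → 9 * (2 * d + (1 + m) * 3) + (8 * m + 20) ≡ 18 * d + (35 * m + 47)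
        tidy = solve-∀

-- The ratio (5k - 9)/(9k) is 5/9 - 1/k, and the loss of 1/k frees 9m². Since 35m + 47 ≤ 82m, the
-- error is at most 82km ≤ m².
ratio-bound : ∀ k m d → 1 ≤ k → 82 * k ≤ m → 5 * (m * m) ≤ 18 * d + (35 * m + 47) →
              (5 * k ∸ 9) * (m C 2) ≤ 9 * k * d
ratio-bound k m d 1≤k large 5m²≤ with ≤-total (5 * k) 9
-- Here `5 * k ∸ 9` truncates to 0 and the claim is trivial.
... | inj₁ 5k≤9 rewrite m≤n⇒m∸n≡0 5k≤9 = z≤n
... | inj₂ 9≤5k = *-cancelˡ-≤ 2 (+-cancelʳ-≤ (9 * (m * m)) _ _ (begin
    2 * (s * (m C 2)) + 9 * (m * m)      ≡⟨ cong (_+ 9 * (m * m)) (assoc s (m C 2)) ⟩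
    s * (2 * (m C 2)) + 9 * (m * m)      ≡⟨ cong (λ t → s * t + 9 * (m * m)) (2*[nC2]≡n*[n∸1] m) ⟩
    s * (m * (m ∸ 1)) + 9 * (m * m)      ≤⟨ +-monoˡ-≤ _ (*-monoʳ-≤ s (*-monoʳ-≤ m (m∸n≤m m 1))) ⟩
    s * (m * m) + 9 * (m * m)            ≡⟨ sym (*-distribʳ-+ (m * m) s 9) ⟩
    (s + 9) * (m * m)                    ≡⟨ cong (_* (m * m)) (m∸n+n≡m 9≤5k) ⟩
    5 * k * (m * m)                      ≡⟨ comm k (m * m) ⟩
    k * (5 * (m * m))                    ≤⟨ *-monoʳ-≤ k 5m²≤ ⟩
    k * (18 * d + (35 * m + 47))         ≤⟨ *-monoʳ-≤ k (+-monoʳ-≤ (18 * d) (+-monoʳ-≤ (35 * m) 47≤47m)) ⟩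
    k * (18 * d + (35 * m + 47 * m))     ≡⟨ regroup k d m ⟩
    2 * (9 * k * d) + 82 * k * m         ≤⟨ +-monoʳ-≤ (2 * (9 * k * d)) (*-monoˡ-≤ m large) ⟩
    2 * (9 * k * d) + m * m              ≤⟨ +-monoʳ-≤ (2 * (9 * k * d)) (m≤m+n (m * m) _) ⟩
    2 * (9 * k * d) + 9 * (m * m)        ∎))
  where
    open ≤-Reasoning
    s = 5 * k ∸ 9
    47≤47m : 47 ≤ 47 * m
    47≤47m = *-monoʳ-≤ 47 {1} (≤-trans 1≤k (≤-trans (m≤m+n k _) large))
    assoc : ∀ s c → 2 * (s * c) ≡ s * (2 * c)
    assoc = solve-∀
    comm : ∀ k M → 5 * k * M ≡ k * (5 * M)
    comm = solve-∀
    regroup : ∀ k d m → k * (18 * d + (35 * m + 47 * m)) ≡ 2 * (9 * k * d) + 82 * k * m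
    regroup = solve-∀

lower-bound : ∀ k → 1 ≤ k → ∀ m → 82 * k ≤ m →
  Σ (ThreeGraph (suc m)) λ G → ¬ HasC5Covering G × ((5 * k ∸ 9) * (m C 2) ≤ 9 * k * δ₁ G)
lower-bound k 1≤k m large =
  graph , hub-uncovered {f0} refl , ratio-bound k m (δ₁ graph) 1≤k large (min-degree-large m)
  where open Construction m (m / 3)

theorem2p5 :
  -- lower bound 5/9 ≤ c₁: for every k ≥ 1, for all large n there is an
  -- n-vertex 3-graph with no C₅-covering and δ₁ ≥ (5/9 − 1/k)·C(n−1,2)
  ((k : ℕ) → 1 ≤ k → Σ ℕ λ N → (m : ℕ) → N ≤ suc m →
    Σ (ThreeGraph (suc m)) λ G →
      ¬ HasC5Covering G × ((5 * k ∸ 9) * (m C 2) ≤ 9 * k * δ₁ G))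
  ×
  -- upper bound c₁ ≤ 2 − √2: for every rational p/k > 2 − √2
  -- (i.e. (2k − p)² < 2k², with truncated subtraction), for all large n
  -- every n-vertex 3-graph without C₅-covering has δ₁ ≤ (p/k)·C(n−1,2)
  ((p k : ℕ) → 1 ≤ k → (2 * k ∸ p) * (2 * k ∸ p) < 2 * k * k →
    Σ ℕ λ N → (m : ℕ) → N ≤ suc m → (G : ThreeGraph (suc m)) →
      ¬ HasC5Covering G → k * δ₁ G ≤ p * (m C 2))
theorem2p5 =
  (λ k 1≤k → suc (82 * k) , λ { m (s≤s large) → lower-bound k 1≤k m large }) ,
  (λ p k _ r²<2k² → threshold p k , λ m large G → upper-bound p k r²<2k² m large G)
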